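{- For every integer $n \ge 1$, the sum of the denominators of all fractions in the Farey sequence $F_n$ equals twice the sum of the numerators of all fractions in $F_n$. That is, if $N_n = \sum_{\frac{a}{b} \in F_n} a$ and $D_n = \sum_{\frac{a}{b}\in F_n} b$, where every fraction $\frac{a}{b}$ is written in reduced form, then $D_n = 2 N_n$.
   Context: For an integer $n\ge 1$, the Farey sequence $F_n$ (in the interval $[0,1]$) is the increasing finite sequence of all rational numbers in $[0,1]$ which, written in reduced form $\frac{a}{b}$ (with $a \ge 0$, $b\ge 1$, $\gcd(a,b)=1$), have denominator $b \le n$. It starts at $\frac{0}{1}$ and ends at $\frac{1}{1}$. For example, $F_1 = \left(\frac{0}{1},\frac{1}{1}\right)$ and $F_3=\left(\frac{0}{1},\frac{1}{3},\frac{1}{2},\frac{2}{3},\frac{1}{1}\right)$. -}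

module Defs where

open import Data.Integer.Base as ℤ using (ℤ; 0ℤ; +_; -[1+_])
import Data.Integer.Properties as ℤ
open import Data.List.Base using (List; []; _∷_; map; foldr; filter; deduplicate; upTo; cartesianProductWith)
open import Data.List.Membership.Propositional using (_∈_)
open import Data.List.Membership.Propositional.Properties
  using (∈-cartesianProductWith⁺; ∈-upTo⁺; ∈-filter⁺; ∈-filter⁻; ∈-deduplicate⁺; ∈-deduplicate⁻)
open import Data.List.Relation.Binary.Permutation.Propositional using (↭-sym; ↭⇒↭ₛ)
open import Data.List.Relation.Binary.Permutation.Propositional.Properties using (∈-resp-↭)
import Data.List.Relation.Binary.Permutation.Setoid.Properties as Permutation
import Data.List.Relation.Unary.AllPairs as AllPairs
open import Data.List.Relation.Unary.Linked using (Linked)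
open import Data.List.Relation.Unary.Linked.Properties using (AllPairs⇒Linked)
open import Data.List.Relation.Unary.Sorted.TotalOrder.Properties using (Sorted⇒AllPairs)
open import Data.List.Relation.Unary.Unique.Propositional using (Unique)
open import Data.Nat.Base as ℕ using (ℕ; suc; s≤s)
import Data.Nat.Properties as ℕ
open import Data.Product.Base using (_×_; _,_; proj₂)
open import Data.Rational.Base using (ℚ; mkℚ; 0ℚ; 1ℚ; ½; _≤_; _<_; *≤*; ↥_; ↧_; ↧ₙ_; _/_)
import Data.Rational.Properties as ℚ
open import Function.Bundles using (_⇔_; mk⇔)
open import Relation.Binary.Bundles using (DecTotalOrder)
open import Relation.Binary.PropositionalEquality using (_≡_; refl; subst; subst₂; setoid)
open import Relation.Nullary.Decidable using (Dec; _×-dec_)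

open import Data.List.Relation.Unary.Unique.DecPropositional.Properties ℚ._≟_ using (deduplicate-!)
open import Data.List.Sort.InsertionSort ℚ.≤-decTotalOrder using (sort; insertionSort)
open import Data.List.Sort.Base (DecTotalOrder.totalOrder ℚ.≤-decTotalOrder) using (module SortingAlgorithm)
open SortingAlgorithm insertionSort using (sort-↭; sort-↗)

-- A value of ℚ carries its reduced form, so ↥ p, ↧ p and ↧ₙ p are the numerator
-- and the (positive) denominator of the reduced fraction.
FareyFraction : ℕ → ℚ → Set
FareyFraction n p = 0ℚ ≤ p × p ≤ 1ℚ × ↧ₙ p ℕ.≤ n

record IsFareySequence (n : ℕ) (F : List ℚ) : Set where
  field
    increasing : Linked _<_ F
    complete   : ∀ p → p ∈ F ⇔ FareyFraction n p

sumℤ : List ℤ → ℤ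
sumℤ = foldr ℤ._+_ 0ℤ

numeratorSum : List ℚ → ℤ
numeratorSum F = sumℤ (map ↥_ F)

denominatorSum : List ℚ → ℤ
denominatorSum F = sumℤ (map ↧_ F)

-- The rest shows that a Farey sequence exists for every n, so that
-- IsFareySequence n is never empty.

fareyFraction? : ∀ n p → Dec (FareyFraction n p)
fareyFraction? n p = (0ℚ ℚ.≤? p) ×-dec (p ℚ.≤? 1ℚ) ×-dec (↧ₙ p ℕ.≤? n)

candidates : ℕ → List ℚ
candidates n = cartesianProductWith (λ a b → + a / suc b) (upTo (suc n)) (upTo n)

farey : ℕ → List ℚ
farey n = sort (deduplicate ℚ._≟_ (filter (fareyFraction? n) (candidates n)))

∈-candidates : ∀ n p → FareyFraction n p → p ∈ candidates n
∈-candidates n p@(mkℚ (+ a) d _) (_ , *≤* a≤d , d<n) =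
  subst (_∈ candidates n) (ℚ.↥p/↧p≡p p)
    (∈-cartesianProductWith⁺ (λ a b → + a / suc b)
      (∈-upTo⁺ (s≤s (ℕ.≤-trans a≤1+d d<n))) (∈-upTo⁺ d<n))
  where
  a≤1+d : a ℕ.≤ suc d
  a≤1+d = ℤ.drop‿+≤+ (subst₂ ℤ._≤_ (ℤ.*-identityʳ (+ a)) (ℤ.*-identityˡ (+ suc d)) a≤d)
∈-candidates n (mkℚ -[1+ _ ] _ _) (*≤* () , _)

farey-isFareySequence : ∀ n → IsFareySequence n (farey n)
farey-isFareySequence n = record
  { increasing = AllPairs⇒Linked (AllPairs.zipWith
      (λ (p≤q , p≢q) → ℚ.≰⇒> λ q≤p → p≢q (ℚ.≤-antisym p≤q q≤p))
      (Sorted⇒AllPairs (DecTotalOrder.totalOrder ℚ.≤-decTotalOrder) (sort-↗ ys) , unique))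
  ; complete = λ p → mk⇔
      (λ p∈ → proj₂ (∈-filter⁻ (fareyFraction? n) {xs = candidates n}
        (∈-deduplicate⁻ ℚ._≟_ xs (∈-resp-↭ (sort-↭ ys) p∈))))
      (λ fp → ∈-resp-↭ (↭-sym (sort-↭ ys))
        (∈-deduplicate⁺ ℚ._≟_ (∈-filter⁺ (fareyFraction? n) (∈-candidates n p fp) fp)))
  }
  where
  xs = filter (fareyFraction? n) (candidates n)
  ys = deduplicate ℚ._≟_ xs
  unique : Unique (farey n)
  unique = Permutation.Unique-resp-↭ (setoid ℚ) (↭⇒↭ₛ (↭-sym (sort-↭ ys))) (deduplicate-! xs)

_ : farey 1 ≡ 0ℚ ∷ 1ℚ ∷ []
_ = refl

_ : farey 3 ≡ 0ℚ ∷ + 1 / 3 ∷ ½ ∷ + 2 / 3 ∷ 1ℚ ∷ []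
_ = refl

{-# OPTIONS --safe #-}
-- The reflection a/b ↦ 1 − a/b = (b − a)/b preserves reduced form and permutes
-- the Farey sequence, so the numerators a and b − a have the same sum N.
-- Adding the two sums gives 2N = D.
module Submission where

open import Defs
open import Data.Integer.Base as ℤ using (ℤ; +_; _*_; ∣_∣; 0ℤ)
import Data.Integer.Properties as ℤ
open import Data.Integer.Divisibility.Signed using (∣ᵤ⇒∣; ∣⇒∣ᵤ; ∣m∣n⇒∣m-n)
open import Data.Integer.Solver using (module +-*-Solver)
open import Data.List.Base using (List; []; _∷_; map)
open import Data.List.Membership.Propositional using (_∈_)
open import Data.List.Membership.Propositional.Properties using (∈-map⁺; ∈-map⁻)
open import Data.List.Membership.Propositional.Properties.WithK using (unique∧set⇒bag)
open import Data.List.Relation.Binary.BagAndSetEquality using (∼bag⇒↭)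
open import Data.List.Relation.Binary.Permutation.Propositional using (_↭_; ↭⇒↭ₛ)
import Data.List.Relation.Binary.Permutation.Propositional.Properties as ↭
import Data.List.Relation.Binary.Permutation.Setoid.Properties as ↭ₛ
import Data.List.Relation.Unary.AllPairs as AllPairs
open import Data.List.Relation.Unary.Linked.Properties using (Linked⇒AllPairs)
open import Data.List.Relation.Unary.Unique.Propositional using (Unique)
import Data.List.Relation.Unary.Unique.Propositional.Properties as Unique
open import Data.Nat.Base using (ℕ; suc; _≤_)
open import Data.Nat.Coprimality using (Coprime)
open import Data.Nat.Divisibility using () renaming (_∣_ to _∣ℕ_)
open import Data.Product.Base using (_,_)
open import Data.Rational.Base using (ℚ; mkℚ; 0ℚ; 1ℚ; ↥_; ↧_; *≤*) renaming (_≤_ to _≤ℚ_)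
import Data.Rational.Properties as ℚ
open import Function.Bundles using (mk⇔; module Equivalence)
open import Relation.Binary.PropositionalEquality using (_≡_; refl; sym; trans; cong; cong₂; subst; subst₂; setoid; module ≡-Reasoning)

-- The map `reflect` sends a/b to (b - a)/b. It is an involution that preserves the defining
-- conditions of a Farey fraction, so it maps the duplicate-free list `F` onto a rearrangement of
-- itself (`map-reflect-↭`). The reflected numerators therefore also sum to N. Since a and b - a add
-- up to b in each term, the two numerator sums together give D (`numeratorSum-reflect`), so D = N +
-- N.

m-[m-n]≡n : ∀ m n → m ℤ.- (m ℤ.- n) ≡ n
m-[m-n]≡n = solve 2 (λ m n → m :- (m :- n) := n) refl
  where open +-*-Solver

-- A common divisor of n - m and n also divides n - (n - m) = m, so it is a common divisor of m and
-- n.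
coprime-complement : ∀ m n → Coprime ∣ m ∣ ∣ n ∣ → Coprime ∣ n ℤ.- m ∣ ∣ n ∣
coprime-complement m n coprime {d} (d∣n-m , d∣n) = coprime (d∣m , d∣n)
  where
  d∣m = subst (λ k → d ∣ℕ ∣ k ∣) (m-[m-n]≡n n m)
    (∣⇒∣ᵤ (∣m∣n⇒∣m-n (∣ᵤ⇒∣ {+ d} {n} d∣n) (∣ᵤ⇒∣ {+ d} {n ℤ.- m} d∣n-m)))

-- This is 1 - p, built from its components rather than by rational subtraction: nothing is
-- renormalised, and the denominator stays the same by computation.
reflect : ℚ → ℚ
reflect (mkℚ a d-1 c) = mkℚ (+ suc d-1 ℤ.- a) d-1 (coprime-complement a (+ suc d-1) c)

reflect-involutive : ∀ p → reflect (reflect p) ≡ p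
reflect-involutive (mkℚ a d-1 _) = ℚ.mkℚ-cong (m-[m-n]≡n (+ suc d-1) a) refl

↥-reflect+↥ : ∀ p → ↥ reflect p ℤ.+ ↥ p ≡ ↧ p
↥-reflect+↥ (mkℚ a d-1 _) = solve 2 (λ b a → b :- a :+ a := b) refl (+ suc d-1) a
  where open +-*-Solver

0≤p⇒0≤↥p : ∀ {p} → 0ℚ ≤ℚ p → 0ℤ ℤ.≤ ↥ p
0≤p⇒0≤↥p {p} (*≤* 0≤p) = subst₂ ℤ._≤_ (ℤ.*-zeroˡ (↧ p)) (ℤ.*-identityʳ (↥ p)) 0≤p

0≤↥p⇒0≤p : ∀ {p} → 0ℤ ℤ.≤ ↥ p → 0ℚ ≤ℚ p
0≤↥p⇒0≤p {p} 0≤↥p = *≤* (subst₂ ℤ._≤_ (sym (ℤ.*-zeroˡ (↧ p))) (sym (ℤ.*-identityʳ (↥ p))) 0≤↥p)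

p≤1⇒↥p≤↧p : ∀ {p} → p ≤ℚ 1ℚ → ↥ p ℤ.≤ ↧ p
p≤1⇒↥p≤↧p {p} (*≤* p≤1) = subst₂ ℤ._≤_ (ℤ.*-identityʳ (↥ p)) (ℤ.*-identityˡ (↧ p)) p≤1

↥p≤↧p⇒p≤1 : ∀ {p} → ↥ p ℤ.≤ ↧ p → p ≤ℚ 1ℚ
↥p≤↧p⇒p≤1 {p} ↥p≤↧p = *≤* (subst₂ ℤ._≤_ (sym (ℤ.*-identityʳ (↥ p))) (sym (ℤ.*-identityˡ (↧ p))) ↥p≤↧p)

-- The two bounds exchange roles: a ≤ b yields 0 ≤ b - a, and 0 ≤ a yields b - a ≤ b. The bound on
-- the denominator carries over verbatim.
reflect-FareyFraction : ∀ {n p} → FareyFraction n p → FareyFraction n (reflect p)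
reflect-FareyFraction {p = mkℚ a d-1 _} (0≤p , p≤1 , d≤n) =
  0≤↥p⇒0≤p (ℤ.i≤j⇒0≤j-i (p≤1⇒↥p≤↧p p≤1)) ,
  ↥p≤↧p⇒p≤1 (ℤ.i-j≤i (+ suc d-1) a {{ℤ.nonNegative (0≤p⇒0≤↥p 0≤p)}}) ,
  d≤n

-- An involution is injective, so `map f xs` has no duplicates; closure under `f` gives it the same
-- members as `xs`. Two duplicate-free lists with the same members are permutations of each other.
map-involution-↭ : ∀ {a} {A : Set a} {f : A → A} {xs : List A} →
                   (∀ x → f (f x) ≡ x) → Unique xs →
                   (∀ {x} → x ∈ xs → f x ∈ xs) → map f xs ↭ xs
map-involution-↭ {f = f} {xs} f-involutive xs! f-closed =
  ∼bag⇒↭ (unique∧set⇒bag (Unique.map⁺ f-injective xs!) xs! (mk⇔ to from))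
  where
  f-injective : ∀ {x y} → f x ≡ f y → x ≡ y
  f-injective {x} {y} fx≡fy =
    trans (sym (f-involutive x)) (trans (cong f fx≡fy) (f-involutive y))

  to : ∀ {y} → y ∈ map f xs → y ∈ xs
  to y∈ with x , x∈xs , refl ← ∈-map⁻ f y∈ = f-closed x∈xs

  from : ∀ {y} → y ∈ xs → y ∈ map f xs
  -- Each y is the image of f y, which lies in `xs` by closure.
  from {y} y∈xs = subst (_∈ map f xs) (f-involutive y) (∈-map⁺ f (f-closed y∈xs))

sumℤ-↭ : ∀ {xs ys} → xs ↭ ys → sumℤ xs ≡ sumℤ ys
sumℤ-↭ xs↭ys = ↭ₛ.foldr-commMonoid (setoid ℤ) ℤ.+-0-isCommutativeMonoid (↭⇒↭ₛ xs↭ys)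

numeratorSum-reflect : ∀ F → numeratorSum (map reflect F) ℤ.+ numeratorSum F ≡ denominatorSum F
numeratorSum-reflect []      = refl
numeratorSum-reflect (p ∷ F) = begin
  (↥ reflect p ℤ.+ N′) ℤ.+ (↥ p ℤ.+ N)  ≡⟨ interchange (↥ reflect p) N′ (↥ p) N ⟩
  (↥ reflect p ℤ.+ ↥ p) ℤ.+ (N′ ℤ.+ N)  ≡⟨ cong₂ ℤ._+_ (↥-reflect+↥ p) (numeratorSum-reflect F) ⟩
  ↧ p ℤ.+ denominatorSum F              ∎
  where
  open ≡-Reasoning
  open import Algebra.Properties.CommutativeSemigroup ℤ.+-commutativeSemigroup using (interchange)
  N′ = numeratorSum (map reflect F)
  N  = numeratorSum F

map-reflect-↭ : ∀ {n F} → IsFareySequence n F → map reflect F ↭ F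
map-reflect-↭ {F = F} isFarey = map-involution-↭ reflect-involutive unique
  λ {p} p∈F → from (complete (reflect p)) (reflect-FareyFraction (to (complete p) p∈F))
  where
  open IsFareySequence isFarey
  open Equivalence using (to; from)
  unique : Unique F
  -- Transitivity extends the strict increase from neighbours to all pairs, which excludes
  -- repetitions.
  unique = AllPairs.map ℚ.<⇒≢ (Linked⇒AllPairs ℚ.<-trans increasing)

theorem2p4 : (n : ℕ) → 1 ≤ n → (F : List ℚ) → IsFareySequence n F → denominatorSum F ≡ + 2 * numeratorSum F
theorem2p4 n 1≤n F isFarey = begin
  denominatorSum F                                  ≡⟨ numeratorSum-reflect F ⟨
  -- Reflection reorders the fractions, and the sum does not depend on their order.
  numeratorSum (map reflect F) ℤ.+ numeratorSum F   ≡⟨ cong (ℤ._+ numeratorSum F) (sumℤ-↭ (↭.map⁺ ↥_ (map-reflect-↭ isFarey))) ⟩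
  numeratorSum F ℤ.+ numeratorSum F                 ≡⟨ double (numeratorSum F) ⟩
  + 2 * numeratorSum F                              ∎
  where
  open ≡-Reasoning
  double : ∀ i → i ℤ.+ i ≡ + 2 * i
  double = solve 1 (λ i → i :+ i := con (+ 2) :* i) refl
    where open +-*-Solver
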